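{- For every connected undirected graph $G$ with max leaf number $ml$ and bandwidth $bw$ we have $bw\leq ml$. This bound is tight, i.e. there are graphs with arbitrarily large max leaf number for which $bw=ml$.
   Context: Graphs are finite, simple, undirected, unweighted and connected, with $n$ nodes. A vertex labeling of $G=(V,E)$ is a bijection $f\colon V\to\{1,\dots,n\}$. The bandwidth $bw$ of $G$ is the minimum of $\max\{|f(u)-f(v)| : \{u,v\}\in E\}$ over all vertex labelings $f$ of $G$. The max leaf number $ml$ of $G$ is the maximum number of leaves of all spanning trees of $G$. -}

module Defs where

open import Data.Fin.Base using (Fin; toℕ)
open import Data.List.Base
  using (List; []; _∷_; _++_; length; map; filter; allFin; cartesianProduct)
open import Data.List.Extrema.Nat using (max)
open import Data.List.Relation.Unary.Linked using (Linked)
open import Data.List.Relation.Unary.Unique.Propositional using (Unique)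
open import Data.Nat.Base using (ℕ; suc; _≤_; ∣_-_∣; NonZero)
open import Data.Nat.Properties using (_≟_)
open import Data.Product.Base using (_×_; _,_; ∃-syntax)
open import Function.Bundles using (_⤖_; module Bijection)
open import Level using (0ℓ)
open import Relation.Binary.Construct.Closure.ReflexiveTransitive using (Star)
open import Relation.Binary.Core using (Rel; _⇒_)
open import Relation.Binary.Definitions using (Decidable; Irreflexive; Symmetric)
open import Relation.Binary.PropositionalEquality.Core using (_≡_)
open import Relation.Nullary.Negation.Core using (¬_)

record Graph (n : ℕ) : Set₁ where
  field
    Adj    : Rel (Fin n) 0ℓ
    adj?   : Decidable Adj
    sym    : Symmetric Adj
    irrefl : Irreflexive _≡_ Adj

open Graph public using (Adj; adj?)

private
  variable
    n : ℕ

Connected : Graph n → Set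
Connected {n} G = NonZero n × (∀ u v → Star (Adj G) u v)

-- Each edge {u , v} is listed twice, as (u , v) and as (v , u).
edges : Graph n → List (Fin n × Fin n)
edges {n} G = filter (λ (u , v) → adj? G u v) (cartesianProduct (allFin n) (allFin n))

Labeling : ℕ → Set
Labeling n = Fin n ⤖ Fin n

-- Shifted by one so that labels range over {1, …, n}.
label : Labeling n → Fin n → ℕ
label f v = suc (toℕ (Bijection.to f v))

-- The maximum over an empty edge set (one-node graph) is 0.
width : Graph n → Labeling n → ℕ
width G f = max 0 (map (λ (u , v) → ∣ label f u - label f v ∣) (edges G))

IsBandwidth : Graph n → ℕ → Set
IsBandwidth {n} G bw =
  (∃[ f ] width G f ≡ bw) × (∀ (f : Labeling n) → bw ≤ width G f)

-- A cycle x, x₁, …, xₖ, x with k ≥ 2 and x, x₁, …, xₖ pairwise distinct.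
record Cycle (G : Graph n) : Set where
  field
    start    : Fin n
    rest     : List (Fin n)
    long     : 2 ≤ length rest
    distinct : Unique (start ∷ rest)
    closed   : Linked (Adj G) (start ∷ rest ++ start ∷ [])

IsTree : Graph n → Set
IsTree T = Connected T × ¬ Cycle T

IsSpanningTree : Graph n → Graph n → Set
IsSpanningTree G T = IsTree T × (Adj T ⇒ Adj G)

degree : Graph n → Fin n → ℕ
degree {n} G v = length (filter (adj? G v) (allFin n))

leaves : Graph n → List (Fin n)
leaves {n} T = filter (λ v → degree T v ≟ 1) (allFin n)

IsMaxLeafNumber : Graph n → ℕ → Set₁
IsMaxLeafNumber {n} G ml =
  (∃[ T ] IsSpanningTree G T × length (leaves T) ≡ ml) ×
  (∀ (T : Graph n) → IsSpanningTree G T → length (leaves T) ≤ ml)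

-- Grow a sequence of vertices by repeatedly appending an unvisited neighbour
-- of the earliest vertex which still has one; that vertex becomes its parent.
-- If an edge joins positions a < b, then a vertex at a position in (a , b] has
-- its parent at a position ≤ a, as the vertex at a is not exhausted before b.
-- So in the tree on the positions ≤ b the positions in (a , b] are b − a
-- childless vertices, and appending a vertex never decreases the number of
-- those: a childless parent is replaced by its new child.  Hence labelling by
-- position has width at most the number of leaves.
--
-- The bound is attained by the complete graphs on n ≥ 3 vertices, where both
-- numbers are n − 1: no tree on at least three vertices consists of leaves.
module Submission where

open import Data.Fin.Base using (Fin; zero; suc; toℕ; fromℕ; fromℕ<)
open import Data.Fin.Properties as Fin
  using (toℕ<n; toℕ-injective; toℕ-fromℕ; toℕ-fromℕ<; fromℕ<-injective;
         injective⇒≤; ¬∀⟶∃¬)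
open import Data.List.Base
  using (List; []; _∷_; _++_; length; allFin; cartesianProduct)
open import Data.List.Extrema.Nat using (max≤v⁺; v≤max⁺)
open import Data.List.Membership.Propositional using (_∈_; lose)
open import Data.List.Membership.Propositional.Properties
  using (∈-filter⁺; ∈-filter⁻; ∈-allFin; ∈-cartesianProduct⁺; ∈-map⁺)
open import Data.List.Properties using (filter-notAll; length-tabulate)
open import Data.List.Relation.Unary.All as All using (All; []; _∷_)
import Data.List.Relation.Unary.All.Properties as All
open import Data.List.Relation.Unary.AllPairs using ([]; _∷_)
open import Data.List.Relation.Unary.Any as Any using (here; there)
open import Data.List.Relation.Unary.Linked using (Linked; _∷_)
open import Data.List.Relation.Unary.Unique.Propositional using (Unique)
import Data.List.Relation.Unary.Unique.Propositional.Properties as Unique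
open import Data.List.Membership.Setoid.Properties using (index-injective)
open import Data.Nat.Base
open import Data.Nat.Properties
open import Data.Product.Base using (Σ-syntax; ∃-syntax; _×_; _,_; proj₁; proj₂)
open import Data.Sum.Base using (_⊎_; inj₁; inj₂; swap)
open import Function.Base using (_∘_; id)
open import Function.Bundles using (module Bijection; mk⤖)
open import Function.Definitions using (Injective)
open import Relation.Binary.Construct.Closure.ReflexiveTransitive
  using (Star; ε; _◅_; _◅◅_; reverse)
open import Relation.Binary.Definitions using (tri<; tri≈; tri>)
open import Relation.Binary.PropositionalEquality
open import Relation.Nullary using (¬_; Dec; yes; no; contradiction; ¬?)
open import Relation.Nullary.Decidable using (_×-dec_; _⊎-dec_; decidable-stable)
open import Relation.Unary using (Pred; Decidable)
open import Defs

private
  variable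
    m n : ℕ

-- Bounded search, list lengths and the width of a labelling

least : ∀ {p} {P : Pred ℕ p} → Decidable P → ∀ i →
        (∃[ j ] (j < i × P j × (∀ a → a < j → ¬ P a))) ⊎ (∀ a → a < i → ¬ P a)
least P? zero = inj₂ λ _ ()
least {P = P} P? (suc i) with least P? i
... | inj₁ (j , j<i , Pj , min) = inj₁ (j , m<n⇒m<1+n j<i , Pj , min)
... | inj₂ none with P? i
...   | yes Pi = inj₁ (i , n<1+n i , Pi , none)
...   | no ¬Pi = inj₂ λ a a<1+i → none′ (m≤n⇒m<n∨m≡n (s≤s⁻¹ a<1+i))
  where
  none′ : ∀ {a} → a < i ⊎ a ≡ i → ¬ P a
  none′ (inj₁ a<i)  = none _ a<i
  none′ (inj₂ refl) = ¬Pi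

length≡1 : ∀ {A : Set} {xs : List A} {y} →
           Unique xs → y ∈ xs → (∀ {x} → x ∈ xs → x ≡ y) → length xs ≡ 1
length≡1 {xs = _ ∷ []}    _                 _ _   = refl
length≡1 {xs = _ ∷ _ ∷ _} ((x≢x′ ∷ _) ∷ _)  _ all =
  contradiction (trans (all (here refl)) (sym (all (there (here refl))))) x≢x′

length≡1⇒≡ : ∀ {A : Set} {xs : List A} {x y} →
             length xs ≡ 1 → x ∈ xs → y ∈ xs → x ≡ y
length≡1⇒≡ {xs = _ ∷ []} _ (here x≡z) (here y≡z) = trans x≡z (sym y≡z)

-- Sending `k` to the index at which `g k` occurs is an injection into `Fin (length xs)`.
injective⇒≤length : ∀ {A : Set} {xs : List A} {g : Fin m → A} →
                    Injective _≡_ _≡_ g → (∀ k → g k ∈ xs) → m ≤ length xs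
injective⇒≤length {A = A} inj g∈ =
  injective⇒≤ {f = Any.index ∘ g∈} (inj ∘ index-injective (setoid A) (g∈ _) (g∈ _))

∈-leaves : (T : Graph n) → ∀ {v} → degree T v ≡ 1 → v ∈ leaves T
∈-leaves T {v} = ∈-filter⁺ _ (∈-allFin v)

-- The hypothesis covers both orientations of an edge and truncated subtraction vanishes on the
-- wrong one, so one-sided bounds control the absolute difference.
width≤ : (G : Graph n) (f : Labeling n) →
         (∀ u v → Adj G u v → label f v ∸ label f u ≤ m) →
         width G f ≤ m
width≤ {m = m} G f bound = max≤v⁺ z≤n (All.map⁺ (All.tabulate {xs = edges G}
  λ {(u , v)} uv∈ → diff u v (proj₂ (∈-filter⁻ (λ (u , v) → adj? G u v)
    {xs = cartesianProduct (allFin _) (allFin _)} uv∈))))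
  where
  diff : ∀ u v → Adj G u v → ∣ label f u - label f v ∣ ≤ m
  diff u v uv with ≤-total (label f u) (label f v)
  ... | inj₁ u≤v = ≤-trans (≤-reflexive (m≤n⇒∣m-n∣≡n∸m u≤v)) (bound u v uv)
  ... | inj₂ v≤u =
    ≤-trans (≤-reflexive (m≤n⇒∣n-m∣≡n∸m v≤u)) (bound v u (Graph.sym G uv))

≤width : (G : Graph n) (f : Labeling n) → ∀ {u v} → Adj G u v →
         ∣ label f u - label f v ∣ ≤ width G f
≤width G f {u} {v} uv = v≤max⁺ 0 _ (inj₂ (lose (∈-map⁺ _ uv∈) ≤-refl))
  where
  uv∈ : (u , v) ∈ edges G
  uv∈ = ∈-filter⁺ (λ (u , v) → adj? G u v)
          (∈-cartesianProduct⁺ (∈-allFin u) (∈-allFin v)) uv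

-- Trees given by a parent function

module ParentTree
  (root : Fin n) (parent : Fin n → Fin n) (pos : Fin n → ℕ)
  (parent< : ∀ {v} → v ≢ root → pos (parent v) < pos v)
  where

  -- The condition `v ≢ root` discards the arbitrary value of `parent` at the root.
  Child : Fin n → Fin n → Set
  Child u v = v ≢ root × u ≡ parent v

  child? : ∀ u v → Dec (Child u v)
  child? u v = ¬? (v Fin.≟ root) ×-dec (u Fin.≟ parent v)

  child< : ∀ {u v} → Child u v → pos u < pos v
  child< (v≢root , refl) = parent< v≢root

  child-unique : ∀ {u u′ v} → Child u v → Child u′ v → u ≡ u′
  child-unique (_ , u≡) (_ , u′≡) = trans u≡ (sym u′≡)

  tree : Graph n
  tree = record
    { Adj    = λ u v → Child u v ⊎ Child v u
    ; adj?   = λ u v → child? u v ⊎-dec child? v u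
    ; sym    = swap
    ; irrefl = λ { refl (inj₁ c) → <-irrefl refl (child< c)
                 ; refl (inj₂ c) → <-irrefl refl (child< c) }
    }

  -- The number `k` bounds the rank of `v`; ranks drop towards parents, so recursion on `k` follows
  -- the path of ancestors.
  root-reachable : ∀ k v → pos v < k → Star (Adj tree) v root
  root-reachable (suc k) v v<k with v Fin.≟ root
  ... | yes refl   = ε
  ... | no  v≢root =
    inj₂ (v≢root , refl) ◅
    root-reachable k (parent v) (<-≤-trans (parent< v≢root) (s≤s⁻¹ v<k))

  tree-connected : NonZero n → Connected tree
  tree-connected nz = nz , λ u v →
    root-reachable _ u ≤-refl ◅◅ reverse swap (root-reachable _ v ≤-refl)

  -- A walk without backtracking that has once moved to a child keeps doing so.
  descend : ∀ {w x y zs} → Unique (w ∷ x ∷ y ∷ zs) →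
            Linked (Adj tree) (y ∷ zs ++ w ∷ []) → Child x y →
            ∃[ z ] (z ∈ y ∷ zs × Child z w × pos y ≤ pos z)
  descend {zs = []} _ (inj₁ yw ∷ _) xy = _ , here refl , yw , ≤-refl
  descend {zs = []} ((w≢x ∷ _) ∷ _) (inj₂ wy ∷ _) xy =
    contradiction (child-unique wy xy) w≢x
  descend {zs = _ ∷ _} ((_ ∷ w∉) ∷ _ ∷ uniq) (inj₁ yz ∷ walk) xy
    with descend (w∉ ∷ uniq) walk yz
  ... | z , z∈ , zw , ≤z = z , there z∈ , zw , ≤-trans (<⇒≤ (child< yz)) ≤z
  descend {zs = _ ∷ _} (_ ∷ (_ ∷ x≢z ∷ _) ∷ _) (inj₂ zy ∷ _) xy =
    contradiction (child-unique xy zy) x≢z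

  -- If the walk goes up to parents all the way to `w`, ranks fall throughout. Once it turns
  -- downward it keeps descending, so its last step enters `w` from the parent of `w`.
  climb : ∀ {w x y zs} → Unique (w ∷ x ∷ y ∷ zs) →
          Linked (Adj tree) (x ∷ y ∷ zs ++ w ∷ []) →
          pos w < pos x ⊎ ∃[ z ] (z ∈ y ∷ zs × Child z w)
  climb uniq (inj₁ xy ∷ walk) with descend uniq walk xy
  ... | z , z∈ , zw , _ = inj₂ (z , z∈ , zw)
  climb {zs = []} _ (inj₂ yx ∷ inj₁ yw ∷ _) = inj₂ (_ , here refl , yw)
  climb {zs = []} _ (inj₂ yx ∷ inj₂ wy ∷ _) = inj₁ (<-trans (child< wy) (child< yx))
  climb {zs = _ ∷ _} ((_ ∷ w∉) ∷ _ ∷ uniq) (inj₂ yx ∷ walk) with climb (w∉ ∷ uniq) walk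
  ... | inj₁ w<y            = inj₁ (<-trans w<y (child< yx))
  ... | inj₂ (z , z∈ , zw)  = inj₂ (z , there z∈ , zw)

  -- If the first step goes down, the second cannot return to `w`, so the walk descends all the way
  -- round and ranks increase along a closed walk. If it goes up, then by `climb` either `w` ranks
  -- below its parent `x`, or the walk ends with a second visit to `x`.
  no-closed-walk : ∀ {w x y zs} → Unique (w ∷ x ∷ y ∷ zs) →
                   ¬ Linked (Adj tree) (w ∷ x ∷ y ∷ zs ++ w ∷ [])
  no-closed-walk ((_ ∷ w≢y ∷ _) ∷ _) (inj₁ wx ∷ inj₂ yx ∷ _) =
    w≢y (child-unique wx yx)
  no-closed-walk {zs = []} _ (inj₁ wx ∷ inj₁ xy ∷ inj₁ yw ∷ _) =
    <-asym (child< yw) (<-trans (child< wx) (child< xy))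
  no-closed-walk {zs = []} ((w≢x ∷ _) ∷ _) (inj₁ wx ∷ inj₁ xy ∷ inj₂ wy ∷ _) =
    w≢x (child-unique wy xy)
  no-closed-walk {zs = _ ∷ _} uniq (inj₁ wx ∷ inj₁ xy ∷ walk)
    with descend uniq walk xy
  ... | z , _ , zw , y≤z =
    <-irrefl refl (<-trans (≤-<-trans y≤z (child< zw)) (<-trans (child< wx) (child< xy)))
  no-closed-walk uniq@(_ ∷ x∉ ∷ _) (inj₂ xw ∷ walk) with climb uniq walk
  ... | inj₁ w<x           = <-asym w<x (child< xw)
  ... | inj₂ (z , z∈ , zw) = All.lookup x∉ z∈ (child-unique xw zw)

  acyclic : ¬ Cycle tree
  acyclic c with Cycle.rest c | Cycle.long c | Cycle.distinct c | Cycle.closed c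
  ... | _ ∷ []    | s≤s () | _    | _
  ... | _ ∷ _ ∷ _ | _      | uniq | walk = no-closed-walk uniq walk

  childless⇒degree≡1 : ∀ {v} → v ≢ root → (∀ w → ¬ Child v w) → degree tree v ≡ 1
  childless⇒degree≡1 {v} v≢root childless = length≡1
    (Unique.filter⁺ (adj? tree v) (Unique.allFin⁺ n))
    (∈-filter⁺ (adj? tree v) (∈-allFin (parent v)) (inj₂ (v≢root , refl)))
    λ x∈ → only (proj₂ (∈-filter⁻ (adj? tree v) {xs = allFin n} x∈))
    where
    only : ∀ {x} → Adj tree v x → x ≡ parent v
    only (inj₁ vx)       = contradiction vx (childless _)
    only (inj₂ (_ , x≡)) = x≡

-- The search order

-- Positions are natural numbers, so `at` is total and inverts `pos` below `n`. The width bound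
-- rests on `parent≤`, the breadth-first property.
record SearchOrder (G : Graph n) : Set where
  field
    pos      : Fin n → ℕ
    at       : ℕ → Fin n
    pos<n    : ∀ v → pos v < n
    at-pos   : ∀ v → at (pos v) ≡ v
    pos-at   : ∀ {k} → k < n → pos (at k) ≡ k
    parent   : Fin n → Fin n
    parent<  : ∀ {v} → v ≢ at 0 → pos (parent v) < pos v
    adjacent : ∀ {v} → v ≢ at 0 → Adj G (parent v) v
    parent≤  : ∀ {u v w} → Adj G u w → pos u < pos v → pos v ≤ pos w →
               pos (parent v) ≤ pos u

module Search (G : Graph n) (reachable : ∀ u v → Star (Adj G) u v) (root : Fin n) where

  Visited : (ℕ → Fin n) → ℕ → Fin n → Set
  Visited s i v = ∃[ k ] (k < i × s k ≡ v)

  visited? : ∀ s i v → Dec (Visited s i v)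
  visited? s i v = anyUpTo? (λ k → s k Fin.≟ v) i

  Exhausted : (ℕ → Fin n) → ℕ → ℕ → Set
  Exhausted s i a = ∀ v → Adj G (s a) v → Visited s i v

  -- Exhaustion is measured just before `s w` is appended: only positions below `w` count as
  -- visited.
  Discovers : (ℕ → Fin n) → ℕ → ℕ → Set
  Discovers s w j = j < w × Adj G (s j) (s w) × (∀ a → a < j → Exhausted s w a)

  -- A search that has placed `i` vertices; only the first `i` values of `seq` are constrained.
  -- Position 0 is the root and has no discoverer.
  record Stage (i : ℕ) : Set where
    field
      seq        : ℕ → Fin n
      fresh      : ∀ {w} → w < i → ¬ Visited seq w (seq w)
      discovered : ∀ {w} → 0 < w → w < i → ∃[ j ] Discovers seq w j

    seq-injective : ∀ {j k} → j < i → k < i → seq j ≡ seq k → j ≡ k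
    seq-injective {j} {k} j<i k<i eq with <-cmp j k
    ... | tri< j<k _ _ = contradiction (j , j<k , eq) (fresh k<i)
    ... | tri≈ _ j≡k _ = j≡k
    ... | tri> _ _ k<j = contradiction (k , k<j , sym eq) (fresh j<i)

  all-visited⇒≤ : ∀ s i → (∀ v → Visited s i v) → n ≤ i
  all-visited⇒≤ s i all = injective⇒≤ {f = λ v → fromℕ< (proj₁ (proj₂ (all v)))}
    λ {u} {v} eq → begin
      u                ≡⟨ proj₂ (proj₂ (all u)) ⟨
      s (proj₁ (all u)) ≡⟨ cong s (fromℕ<-injective _ _ _ _ eq) ⟩
      s (proj₁ (all v)) ≡⟨ proj₂ (proj₂ (all v)) ⟩
      v                ∎
    where open ≡-Reasoning

  -- An unvisited vertex together with the `n` distinct entries would inject `Fin (suc n)` into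
  -- `Fin n`.
  all-visited : (st : Stage n) → ∀ v → Visited (Stage.seq st) n v
  all-visited st v = decidable-stable (visited? seq n v) λ unvisited →
    <-irrefl refl (injective⇒≤ (inj unvisited))
    where
    open Stage st
    extended : Fin (suc n) → Fin n
    extended zero    = v
    extended (suc k) = seq (toℕ k)
    inj : ¬ Visited seq n v → Injective _≡_ _≡_ extended
    inj _  {zero}  {zero}  _  = refl
    inj ¬v {zero}  {suc k} eq = contradiction (toℕ k , toℕ<n k , sym eq) ¬v
    inj ¬v {suc k} {zero}  eq = contradiction (toℕ k , toℕ<n k , eq) ¬v
    inj _  {suc j} {suc k} eq =
      cong suc (toℕ-injective (seq-injective (toℕ<n j) (toℕ<n k) eq))

  append : (ℕ → Fin n) → ℕ → Fin n → ℕ → Fin n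
  append s i x k with k <? i
  ... | yes _ = s k
  ... | no  _ = x

  append-< : ∀ s {i k} x → k < i → append s i x k ≡ s k
  append-< s {i} {k} x k<i with k <? i
  ... | yes _  = refl
  ... | no k≮i = contradiction k<i k≮i

  append-≡ : ∀ s i x → append s i x i ≡ x
  append-≡ s i x with i <? i
  ... | yes i<i = contradiction i<i (<-irrefl refl)
  ... | no  _   = refl

  -- Statements about the first `w ≤ i` entries do not see the entry at `i`, so the history of the
  -- search survives an append.
  module _ (s : ℕ → Fin n) {i : ℕ} (x : Fin n) where

    append-visited⁺ : ∀ {w v} → w ≤ i → Visited s w v → Visited (append s i x) w v
    append-visited⁺ w≤i (k , k<w , refl) = k , k<w , append-< s x (<-≤-trans k<w w≤i)

    append-visited⁻ : ∀ {w v} → w ≤ i → Visited (append s i x) w v → Visited s w v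
    append-visited⁻ w≤i (k , k<w , refl) =
      k , k<w , sym (append-< s x (<-≤-trans k<w w≤i))

    append-exhausted : ∀ {w a} → w ≤ i → a < w → Exhausted s w a →
                       Exhausted (append s i x) w a
    append-exhausted w≤i a<w ex v av = append-visited⁺ w≤i
      (ex v (subst (λ u → Adj G u v) (append-< s x (<-≤-trans a<w w≤i)) av))

  Frontier : (ℕ → Fin n) → ℕ → ℕ → Set
  Frontier s i a = ∃[ v ] (Adj G (s a) v × ¬ Visited s i v)

  frontier? : ∀ s i a → Dec (Frontier s i a)
  frontier? s i a = Fin.any? λ v → adj? G (s a) v ×-dec ¬? (visited? s i v)

  ¬frontier⇒exhausted : ∀ {s i a} → ¬ Frontier s i a → Exhausted s i a
  ¬frontier⇒exhausted ¬f v av =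
    decidable-stable (visited? _ _ v) λ ¬v → ¬f (v , av , ¬v)

  -- The visited set is closed under adjacency, so no walk from the first entry leaves it.
  all-exhausted⇒all-visited : ∀ s i → 0 < i → (∀ a → a < i → Exhausted s i a) →
                              ∀ v → Visited s i v
  all-exhausted⇒all-visited s i 0<i ex v = follow (0 , 0<i , refl) (reachable (s 0) v)
    where
    follow : ∀ {u w} → Visited s i u → Star (Adj G) u w → Visited s i w
    follow vis                 ε        = vis
    follow (k , k<i , refl) (uw ◅ walk) = follow (ex k k<i _ uw) walk

  step : ∀ {i} → 0 < i → i < n → Stage i → Stage (suc i)
  step {i} 0<i i<n st with least (frontier? (Stage.seq st) i) i
  -- If no visited vertex had an unvisited neighbour, all `n` vertices would already occupy `i < n`
  -- positions.
  ... | inj₂ none = contradiction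
    (all-visited⇒≤ seq i (all-exhausted⇒all-visited seq i 0<i
      λ a a<i → ¬frontier⇒exhausted (none a a<i)))
    (<⇒≱ i<n)
    where open Stage st
  ... | inj₁ (j , j<i , (x , jx , ¬x) , min) = record
    { seq        = seq′
    ; fresh      = λ w<1+i → fresh′ (m≤n⇒m<n∨m≡n (s≤s⁻¹ w<1+i))
    ; discovered = λ 0<w w<1+i → discovered′ 0<w (m≤n⇒m<n∨m≡n (s≤s⁻¹ w<1+i))
    }
    where
    open Stage st
    seq′ = append seq i x

    fresh′ : ∀ {w} → w < i ⊎ w ≡ i → ¬ Visited seq′ w (seq′ w)
    fresh′ (inj₁ w<i) vis = fresh w<i
      (subst (Visited seq _) (append-< seq x w<i) (append-visited⁻ seq x (<⇒≤ w<i) vis))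
    fresh′ (inj₂ refl) vis = ¬x
      (subst (Visited seq _) (append-≡ seq i x) (append-visited⁻ seq x ≤-refl vis))

    discovered′ : ∀ {w} → 0 < w → w < i ⊎ w ≡ i → ∃[ j ] Discovers seq′ w j
    discovered′ 0<w (inj₁ w<i) with discovered 0<w w<i
    ... | j′ , j′<w , adj , ex = j′ , j′<w ,
      subst₂ (Adj G) (sym (append-< seq x (<-trans j′<w w<i))) (sym (append-< seq x w<i)) adj ,
      λ a a<j′ → append-exhausted seq x (<⇒≤ w<i) (<-trans a<j′ j′<w) (ex a a<j′)
    discovered′ 0<w (inj₂ refl) = j , j<i ,
      subst₂ (Adj G) (sym (append-< seq x j<i)) (sym (append-≡ seq i x)) jx ,
      -- Since `j` is the least position with an unvisited neighbour, all earlier ones are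
      -- exhausted.
      λ a a<j → append-exhausted seq x ≤-refl (<-trans a<j j<i)
                  (¬frontier⇒exhausted (min a a<j))

  stage : ∀ i → i < n → Stage (suc i)
  stage zero    _   = record
    { seq        = λ _ → root
    ; fresh      = λ { (s≤s z≤n) (_ , () , _) }
    ; discovered = λ { (s≤s z≤n) (s≤s ()) }
    }
  stage (suc i) i<n = step z<s i<n (stage i (<-trans (n<1+n i) i<n))

  order : Stage n → SearchOrder G
  order st = record
    { pos      = pos
    ; at       = seq
    ; pos<n    = pos<n
    ; at-pos   = at-pos
    ; pos-at   = pos-at
    ; parent   = parent
    ; parent<  = λ v≢ → let (j<v , _) = parent-discovers v≢ in
                   subst (_< _) (sym (pos-parent v≢)) j<v
    ; adjacent = λ v≢ → let (_ , adj , _) = parent-discovers v≢ in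
                   subst (Adj G _) (at-pos _) adj
    ; parent≤  = parent≤
    }
    where
    open Stage st

    pos : Fin n → ℕ
    pos v = proj₁ (all-visited st v)

    pos<n : ∀ v → pos v < n
    pos<n v = proj₁ (proj₂ (all-visited st v))

    at-pos : ∀ v → seq (pos v) ≡ v
    at-pos v = proj₂ (proj₂ (all-visited st v))

    pos-at : ∀ {k} → k < n → pos (seq k) ≡ k
    pos-at k<n = seq-injective (pos<n _) k<n (at-pos _)

    0<pos : ∀ {v} → v ≢ seq 0 → 0 < pos v
    0<pos v≢ = n≢0⇒n>0 λ pos≡0 → v≢ (trans (sym (at-pos _)) (cong seq pos≡0))

    discoverer : ∀ {v} → v ≢ seq 0 → ∃[ j ] Discovers seq (pos v) j
    discoverer v≢ = discovered (0<pos v≢) (pos<n _)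

    parent : Fin n → Fin n
    parent v with v Fin.≟ seq 0
    -- The root has no discoverer and gets itself as a default.
    ... | yes _ = v
    ... | no v≢ = seq (proj₁ (discoverer v≢))

    parent-at : ∀ {v} → v ≢ seq 0 →
                ∃[ j ] (Discovers seq (pos v) j × parent v ≡ seq j)
    parent-at {v} v≢ with v Fin.≟ seq 0
    ... | yes v≡ = contradiction v≡ v≢
    ... | no v≢′ = proj₁ (discoverer v≢′) , proj₂ (discoverer v≢′) , refl

    parentPos : ∀ {v} → v ≢ seq 0 → ℕ
    parentPos v≢ = proj₁ (parent-at v≢)

    pos-parent : ∀ {v} (v≢ : v ≢ seq 0) → pos (parent v) ≡ parentPos v≢
    pos-parent v≢ with parent-at v≢
    ... | j , (j<v , _) , eq = trans (cong pos eq) (pos-at (<-trans j<v (pos<n _)))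

    parent-discovers : ∀ {v} (v≢ : v ≢ seq 0) →
      parentPos v≢ < pos v × Adj G (parent v) (seq (pos v)) ×
      (∀ a → a < parentPos v≢ → Exhausted seq (pos v) a)
    parent-discovers {v} v≢ with parent-at v≢
    ... | j , (j<v , adj , ex) , eq = j<v , subst (λ u → Adj G u (seq (pos v))) (sym eq) adj , ex

    -- If `u` came before the parent of `v`, it was exhausted when `v` was appended. Its neighbour
    -- `w` would then stand before `v`.
    parent≤ : ∀ {u v w} → Adj G u w → pos u < pos v → pos v ≤ pos w →
              pos (parent v) ≤ pos u
    parent≤ {u} {v} {w} uw u<v v≤w = ≮⇒≥ λ u<p →
      let (k , k<v , sk≡w) = proj₂ (proj₂ (parent-discovers v≢)) (pos u)
            (subst (_ <_) (pos-parent v≢) u<p) w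
            (subst (λ z → Adj G z w) (sym (at-pos u)) uw)
          k<n = <-trans k<v (pos<n v)
      in <-irrefl refl (<-≤-trans
           (subst (_< pos v) (trans (sym (pos-at k<n)) (cong pos sk≡w)) k<v) v≤w)
      where
      0<n : 0 < n
      0<n = ≤-<-trans z≤n (pos<n v)
      v≢ : v ≢ seq 0
      v≢ v≡ = n≮0 (subst (pos u <_) (trans (cong pos v≡) (pos-at 0<n)) u<v)

searchOrder : (G : Graph n) → Connected G → SearchOrder G
searchOrder {suc n} G (_ , reachable) = order (stage n ≤-refl)
  where open Search G reachable zero

-- The search tree and its leaves

module SearchTree (G : Graph n) (nonZero : NonZero n) (o : SearchOrder G) where
  open SearchOrder o
  open ParentTree (at 0) parent pos parent< public

  pos-injective : ∀ {u v} → pos u ≡ pos v → u ≡ v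
  pos-injective eq = trans (sym (at-pos _)) (trans (cong at eq) (at-pos _))

  0<pos⇒≢root : ∀ {v} → 0 < pos v → v ≢ at 0
  0<pos⇒≢root 0<v refl =
    <-irrefl refl (subst (0 <_) (pos-at (>-nonZero⁻¹ n {{nonZero}})) 0<v)

  spanning : IsSpanningTree G tree
  spanning = (tree-connected nonZero , acyclic) ,
    λ { (inj₁ (v≢ , refl)) → adjacent v≢
      ; (inj₂ (u≢ , refl)) → Graph.sym G (adjacent u≢) }

  -- A leaf other than the root of the subtree on the positions < i.
  Tip : ℕ → Fin n → Set
  Tip i v = 0 < pos v × pos v < i × (∀ w → pos w < i → ¬ Child v w)

  Tips : ℕ → ℕ → Set
  Tips m i = Σ[ g ∈ (Fin m → Fin n) ] (Injective _≡_ _≡_ g × (∀ k → Tip i (g k)))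

  grow : ∀ {i} → 0 < i → i < n → Tips m i → Tips m (suc i)
  grow {m = m} {i = i} 0<i i<n (g , g-inj , tip) =
    g′ , (λ {k} {l} → g′-inj k l) , tip′
    where
    x = at i

    pos-x : pos x ≡ i
    pos-x = pos-at i<n

    g≢x : ∀ k → g k ≢ x
    g≢x k gk≡x = <-irrefl (trans (cong pos gk≡x) pos-x) (proj₁ (proj₂ (tip k)))

    g′ : Fin m → Fin n
    g′ k with g k Fin.≟ parent x
    ... | yes _ = x
    ... | no  _ = g k

    g′-inj : ∀ k l → g′ k ≡ g′ l → k ≡ l
    g′-inj k l eq with g k Fin.≟ parent x | g l Fin.≟ parent x
    ... | yes k≡ | yes l≡ = g-inj (trans k≡ (sym l≡))
    -- In the mixed cases `x` would be an old tip, but its position `i` is new.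
    ... | yes _  | no _   = contradiction (sym eq) (g≢x l)
    ... | no _   | yes _  = contradiction eq (g≢x k)
    ... | no _   | no _   = g-inj eq

    tip′ : ∀ k → Tip (suc i) (g′ k)
    tip′ k with g k Fin.≟ parent x
    ... | yes _ =
      subst (0 <_) (sym pos-x) 0<i ,
      s≤s (≤-reflexive pos-x) ,
      λ w w<1+i xw → <⇒≱ (child< xw) (≤-trans (s≤s⁻¹ w<1+i) (≤-reflexive (sym pos-x)))
    ... | no gk≢ with tip k
    ...   | 0<gk , gk<i , childless =
      0<gk , m<n⇒m<1+n gk<i , λ w w<1+i → old w (m≤n⇒m<n∨m≡n (s≤s⁻¹ w<1+i))
      where
      old : ∀ w → pos w < i ⊎ pos w ≡ i → ¬ Child (g k) w
      old w (inj₁ w<i) = childless w w<i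
      old w (inj₂ w≡i) (_ , gk≡) = gk≢ (trans gk≡
        (cong parent (pos-injective (trans w≡i (sym pos-x)))))

  -- The start `i` stays fixed and the recursion is on the end `j`, so `grow` adds the vertex at the
  -- last position.
  grow* : ∀ {i} j → 0 < i → i ≤ j → j ≤ n → Tips m i → Tips m j
  grow* j 0<i i≤j j≤n tips with m≤n⇒m<n∨m≡n i≤j
  ... | inj₂ refl = tips
  grow* (suc j) 0<i i≤j j≤n tips | inj₁ i<1+j =
    grow (<-≤-trans 0<i (s≤s⁻¹ i<1+j)) j≤n
      (grow* j 0<i (s≤s⁻¹ i<1+j) (<⇒≤ j≤n) tips)

  tips⇒≤leaves : Tips m n → m ≤ length (leaves tree)
  tips⇒≤leaves (g , g-inj , tip) = injective⇒≤length g-inj λ k →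
    let (0<gk , _ , childless) = tip k in
    ∈-leaves tree (childless⇒degree≡1 (0<pos⇒≢root 0<gk) λ w → childless w (pos<n w))

  edge-tips : ∀ {u v} → Adj G u v → Tips (pos v ∸ pos u) (suc (pos v))
  edge-tips {u} {v} uv = g , (λ {k} {l} → g-inj k l) , tip
    where
    place : Fin (pos v ∸ pos u) → ℕ
    place k = suc (pos u) + toℕ k

    place≤ : ∀ k → place k ≤ pos v
    place≤ k = ≤-trans (+-monoʳ-< (pos u) (toℕ<n k))
      -- The existence of `k` shows that the truncated difference is nonzero, hence `pos u < pos v`.
      (≤-reflexive (m+[n∸m]≡n {pos u} {pos v} (<⇒≤ (m∸n≢0⇒n<m (m<n⇒n≢0 (toℕ<n k))))))

    g : Fin (pos v ∸ pos u) → Fin n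
    g k = at (place k)

    pos-g : ∀ k → pos (g k) ≡ place k
    pos-g k = pos-at (≤-<-trans (place≤ k) (pos<n v))

    g-inj : ∀ k l → g k ≡ g l → k ≡ l
    g-inj k l eq = toℕ-injective (+-cancelˡ-≡ (suc (pos u)) _ _
      (trans (sym (pos-g k)) (trans (cong pos eq) (pos-g l))))

    u<g : ∀ k → pos u < pos (g k)
    u<g k = subst (pos u <_) (sym (pos-g k)) (s≤s (m≤m+n (pos u) (toℕ k)))

    tip : ∀ k → Tip (suc (pos v)) (g k)
    tip k =
      ≤-<-trans z≤n (u<g k) ,
      s≤s (subst (_≤ pos v) (sym (pos-g k)) (place≤ k)) ,
      -- A child of `g k` placed by then lies in the range of `parent≤`, which would put `g k` at or
      -- before `u`.
      λ { w w≤v c@(_ , gk≡) → <⇒≱ (u<g k) (subst (λ z → pos z ≤ pos u) (sym gk≡)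
            (parent≤ uv (<-trans (u<g k) (child< c)) (s≤s⁻¹ w≤v))) }

  edge≤leaves : ∀ {u v} → Adj G u v → pos v ∸ pos u ≤ length (leaves tree)
  edge≤leaves {v = v} uv = tips⇒≤leaves (grow* n z<s (pos<n v) ≤-refl (edge-tips uv))

  labeling : Labeling n
  labeling = mk⤖ {to = λ v → fromℕ< (pos<n v)}
    ( (λ eq → pos-injective (fromℕ<-injective _ _ _ _ eq))
    , λ k → at (toℕ k) , λ { refl → toℕ-injective
        (trans (toℕ-fromℕ< (pos<n _)) (pos-at (toℕ<n k))) } )

  label≡ : ∀ v → label labeling v ≡ suc (pos v)
  label≡ v = cong suc (toℕ-fromℕ< (pos<n v))

  width≤leaves : width G labeling ≤ length (leaves tree)
  width≤leaves = width≤ G labeling λ u v uv →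
    ≤-trans (≤-reflexive (cong₂ _∸_ (label≡ v) (label≡ u))) (edge≤leaves uv)

-- Bandwidth against max leaf number

∃-width≤leaves : (G : Graph n) → Connected G →
  ∃[ f ] ∃[ T ] (IsSpanningTree G T × width G f ≤ length (leaves T))
∃-width≤leaves G conn = labeling , tree , spanning , width≤leaves
  where open SearchTree G (proj₁ conn) (searchOrder G conn)

bandwidth≤maxLeafNumber : (G : Graph n) → Connected G →
  ∀ bw ml → IsBandwidth G bw → IsMaxLeafNumber G ml → bw ≤ ml
bandwidth≤maxLeafNumber G conn bw ml (_ , bw≤) (_ , ≤ml) =
  let (f , T , spanning , w≤) = ∃-width≤leaves G conn
  in ≤-trans (bw≤ f) (≤-trans w≤ (≤ml T spanning))

-- The chain `b ≤ width G f ≤ length (leaves T) ≤ b` collapses for the search labelling and the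
-- search tree, so these attain both extrema.
sandwich : (G : Graph n) → Connected G → ∀ b →
  (∀ f → b ≤ width G f) → (∀ T → IsSpanningTree G T → length (leaves T) ≤ b) →
  IsBandwidth G b × IsMaxLeafNumber G b
sandwich G conn b b≤ ≤b with ∃-width≤leaves G conn
... | f , T , spanning , w≤ =
  ((f , ≤-antisym (≤-trans w≤ (≤b T spanning)) (b≤ f)) , b≤) ,
  ((T , spanning , ≤-antisym (≤b T spanning) (≤-trans (b≤ f) w≤)) , ≤b)

-- Complete graphs

complete : ∀ n → Graph n
complete n = record
  { Adj    = _≢_
  ; adj?   = λ u v → ¬? (u Fin.≟ v)
  ; sym    = ≢-sym
  ; irrefl = λ u≡v u≢v → u≢v u≡v
  }

complete-connected : ∀ n → Connected (complete (suc n))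
complete-connected n = _ , reach
  where
  reach : ∀ u v → Star _≢_ u v
  reach u v with u Fin.≟ v
  ... | yes refl = ε
  ... | no u≢v   = u≢v ◅ ε

-- The vertices with the smallest and the largest label are adjacent as soon as they differ. On a
-- single vertex they coincide, and the bound is 0.
n≤width-complete : (f : Labeling (suc n)) → n ≤ width (complete (suc n)) f
n≤width-complete {zero}  f = z≤n
n≤width-complete {suc n} f = ≤-trans (≤-reflexive (sym difference))
  (≤width (complete _) f first≢last)
  where
  open Bijection f using (to; surjective)
  first = proj₁ (surjective zero)
  last  = proj₁ (surjective (fromℕ (suc n)))

  to-first : to first ≡ zero
  to-first = proj₂ (surjective zero) refl

  to-last : to last ≡ fromℕ (suc n)
  to-last = proj₂ (surjective (fromℕ (suc n))) refl

  first≢last : first ≢ last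
  first≢last eq with trans (sym to-first) (trans (cong to eq) to-last)
  ... | ()

  difference : ∣ label f first - label f last ∣ ≡ suc n
  difference = trans
    (cong₂ (λ a b → ∣ toℕ a - toℕ b ∣) to-first to-last) (cong suc (toℕ-fromℕ n))

-- If every vertex were a leaf, a vertex and its neighbour would form a component.
∃-nonleaf : (T : Graph (3 + n)) → Connected T → ∃[ v ] degree T v ≢ 1
∃-nonleaf {n} T (_ , reachable) =
  ¬∀⟶∃¬ _ _ (λ v → degree T v ≟ 1) λ all-leaves →
    let neighbour , 0~neighbour = firstNeighbour (reachable zero (suc zero))
    in three-in-pair λ v → stays all-leaves 0~neighbour (inj₁ refl) (reachable zero v)
  where
  firstNeighbour : Star (Adj T) zero (suc zero) → ∃[ v ] Adj T zero v
  firstNeighbour (0v ◅ _) = _ , 0v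

  module _ (all-leaves : ∀ v → degree T v ≡ 1) where
    only : ∀ {u v w} → Adj T u v → Adj T u w → w ≡ v
    only {u} {v} {w} uv uw = length≡1⇒≡ (all-leaves u)
      (∈-filter⁺ (adj? T u) (∈-allFin w) uw) (∈-filter⁺ (adj? T u) (∈-allFin v) uv)

    stays : ∀ {a b u v} → Adj T a b → u ≡ a ⊎ u ≡ b → Star (Adj T) u v → v ≡ a ⊎ v ≡ b
    stays ab u∈ ε = u∈
    stays ab (inj₁ refl) (uw ◅ walk) = stays ab (inj₂ (only ab uw)) walk
    stays ab (inj₂ refl) (uw ◅ walk) = stays ab (inj₁ (only (Graph.sym T ab) uw)) walk

  three-in-pair : ∀ {b : Fin (3 + n)} → ¬ (∀ v → v ≡ zero ⊎ v ≡ b)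
  three-in-pair in-pair with in-pair (suc zero) | in-pair (suc (suc zero))
  ... | inj₂ refl | inj₂ ()

-- A nonleaf fails the filter, so the list of leaves is strictly shorter than the list of all
-- vertices.
leaves-complete≤ : (T : Graph (3 + n)) → Connected T → length (leaves T) ≤ 2 + n
leaves-complete≤ {n} T conn = s≤s⁻¹ (≤-trans
  (filter-notAll (λ v → degree T v ≟ 1) (allFin (3 + n)) (lose (∈-allFin v) nonleaf))
  (≤-reflexive (length-tabulate {n = 3 + n} id)))
  where
  v = proj₁ (∃-nonleaf T conn)
  nonleaf = proj₂ (∃-nonleaf T conn)

lemma16 : (∀ {n} (G : Graph n) → Connected G →
    ∀ bw ml → IsBandwidth G bw → IsMaxLeafNumber G ml → bw ≤ ml)
    ×
    (∀ (k : ℕ) → ∃[ n ] ∃[ G ] ∃[ bw ] ∃[ ml ]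
    (Connected {n} G × IsBandwidth G bw × IsMaxLeafNumber G ml ×
    k ≤ ml × bw ≡ ml))
lemma16 = bandwidth≤maxLeafNumber , tight
  where
  tight : ∀ k → ∃[ n ] ∃[ G ] ∃[ bw ] ∃[ ml ]
    (Connected {n} G × IsBandwidth G bw × IsMaxLeafNumber G ml × k ≤ ml × bw ≡ ml)
  tight k =
    -- With `3 + k` vertices there are always the three that a nonleaf requires, and the common
    -- value `2 + k` is at least `k`.
    let conn    = complete-connected (2 + k)
        bw , ml = sandwich (complete (3 + k)) conn (2 + k) n≤width-complete
                    λ T ((conn-T , _) , _) → leaves-complete≤ T conn-T
    in 3 + k , complete (3 + k) , 2 + k , 2 + k , conn , bw , ml , m≤n+m k 2 , refl
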